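{- For each of the two greedy heuristics Weight-Greedy and DFS-Greedy, the expected block cost of the greedy layout can be a factor of $\Omega(\log B/\log\log B)$ more than the expected block cost of the optimal layout. That is, there exist constants $c>0$ and $B_0$ such that for every $B\ge B_0$ there exist a finite rooted tree and a probability distribution on its leaves for which the expected block cost of the layout produced by the heuristic with block size $B$ is at least $c\,\frac{\log B}{\log\log B}$ times the expected block cost of the optimal layout with block size $B$.
   Context: The tree is a finite rooted tree with fixed parent/child structure (arbitrary degrees) and a given probability distribution on its leaves. The probability of a node is the probability that the node lies on the root-to-leaf path of a leaf selected at random according to the distribution, i.e., the sum of the probabilities of the leaves in its subtree. A layout with block size $B$ is a partition of the nodes into blocks, each containing at most $B$ nodes. The expected block cost of a layout is the expected number of (distinct) blocks containing nodes of the root-to-leaf path of a random leaf. The optimal layout with block size $B$ minimizes the expected block cost over all layouts with block size $B$. Weight-Greedy (block size $B$): start with a root block containing just the root; repeatedly add to the root block the maximum-probability node not already in it (such a node can be taken to be adjacent to the connected subtree built so far) until the block contains $B$ nodes or the tree is exhausted; then conceptually remove the nodes of the root block and lay out each of the remaining subtrees recursively and separately (each starting with its own new root block). DFS-Greedy (block size $B$): order the nodes by the time they are first visited in a depth-first search from the root that visits the children of each node in order of decreasing probability; then cut this order into consecutive blocks of size $B$ (the last one possibly smaller). This layout is not necessarily convex, i.e., its blocks need not be connected. -}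

module Defs where

open import Algebra.Properties.CommutativeMonoid.Sum using (sum)
open import Data.Fin.Base using (Fin)
import Data.Fin.Properties as Fin
open import Data.Integer.Base using (+_)
open import Data.List.Base
  using (List; []; _∷_; [_]; _++_; map; concat; tabulate; filter; length; take; drop)
import Data.List.Membership.DecPropositional as DecMembership
open import Data.List.Relation.Binary.Permutation.Propositional using (_↭_)
open import Data.List.Relation.Unary.All using (All)
open import Data.List.Relation.Unary.AllPairs using (AllPairs)
open import Data.List.Relation.Unary.Any using (Any; any?)
open import Data.Nat.Base as ℕ using (ℕ; zero; suc)
open import Data.Nat.Logarithm using (⌊log₂_⌋; ⌈log₂_⌉)
open import Data.Product.Base using (_×_; ∃-syntax)
open import Data.Rational.Base using (ℚ; 0ℚ; 1ℚ; _*_; _≤_; _/_)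
open import Data.Rational.Properties using (+-0-commutativeMonoid)
open import Function.Base using (_∘_)
open import Relation.Binary.Definitions using (DecidableEquality)
open import Relation.Binary.PropositionalEquality.Core using (_≡_; refl)
open import Relation.Nullary.Decidable using (yes; no)

fromℕ : ℕ → ℚ
fromℕ n = + n / 1

------------------------------------------------------------------------
-- Trees

data Tree : Set where
  node : (d : ℕ) → (Fin d → Tree) → Tree

data Node : Tree → Set where
  here  : ∀ {t} → Node t
  there : ∀ {d ts} (i : Fin d) → Node (ts i) → Node (node d ts)

data Leaf : Tree → Set where
  here  : ∀ {ts} → Leaf (node 0 ts)
  there : ∀ {d ts} (i : Fin d) → Leaf (ts i) → Leaf (node d ts)

_≟_ : ∀ {t} → DecidableEquality (Node t)
here      ≟ here      = yes refl
here      ≟ there _ _ = no λ ()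
there _ _ ≟ here      = no λ ()
there i u ≟ there j v with i Fin.≟ j
... | no i≢j = no λ { refl → i≢j refl }
... | yes refl with u ≟ v
...   | yes refl = yes refl
...   | no u≢v   = no λ { refl → u≢v refl }

nodes : (t : Tree) → List (Node t)
nodes (node d ts) = here ∷ concat (tabulate λ i → map (there i) (nodes (ts i)))

children : ∀ {t} → Node t → List (Node t)
children {node d ts} here = tabulate λ i → there i here
children (there i v)      = map (there i) (children v)

path : ∀ {t} → Leaf t → List (Node t)
path here        = [ here ]
path (there i ℓ) = here ∷ map (there i) (path ℓ)

------------------------------------------------------------------------
-- Probability distributions on the leaves

∑leaves : (t : Tree) → (Leaf t → ℚ) → ℚ
∑leaves (node zero    ts) p = p here
∑leaves (node (suc d) ts) p =
  sum +-0-commutativeMonoid λ i → ∑leaves (ts i) (p ∘ there i)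

IsDistribution : (t : Tree) → (Leaf t → ℚ) → Set
IsDistribution t p = (∀ ℓ → 0ℚ ≤ p ℓ) × ∑leaves t p ≡ 1ℚ

prob : ∀ {t} → (Leaf t → ℚ) → Node t → ℚ
prob {t} p here  = ∑leaves t p
prob p (there i v) = prob (p ∘ there i) v

------------------------------------------------------------------------
-- Layouts

Layout : Tree → Set
Layout t = List (List (Node t))

-- Empty blocks are tolerated: they meet no path, so they cost nothing.
IsLayout : ℕ → {t : Tree} → Layout t → Set
IsLayout B {t} L = concat L ↭ nodes t × All (λ b → length b ℕ.≤ B) L

blocksOnPath : ∀ {t} → Layout t → Leaf t → ℕ
blocksOnPath L ℓ = length (filter (any? (_∈? path ℓ)) L)
  where open DecMembership _≟_ using (_∈?_)

expectedCost : ∀ {t} → (Leaf t → ℚ) → Layout t → ℚ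
expectedCost {t} p L = ∑leaves t λ ℓ → p ℓ * fromℕ (blocksOnPath L ℓ)

IsOptimal : ℕ → ∀ {t} → (Leaf t → ℚ) → Layout t → Set
IsOptimal B {t} p L =
  IsLayout B L ×
  (∀ (L′ : Layout t) → IsLayout B L′ → expectedCost p L ≤ expectedCost p L′)

------------------------------------------------------------------------
-- The greedy heuristics.  They are relations between the input and the
-- output because ties between equal probabilities may be broken arbitrarily.

module _ {t : Tree} (p : Leaf t → ℚ) where

  -- Grow n F b F′: starting from the frontier F, at most n nodes b are added
  -- to the current block, one by one, leaving the frontier F′.  The nodes not
  -- yet laid out are those in the subtrees rooted at the frontier, and a node
  -- is at most as probable as its ancestors, so a most probable frontier node
  -- is a most probable node outside the block.
  data Grow : ℕ → List (Node t) → List (Node t) → List (Node t) → Set where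
    full      : ∀ {F} → Grow 0 F [] F
    exhausted : ∀ {n} → Grow n [] [] []
    add       : ∀ {n F v F₁ b F′} →
                F ↭ v ∷ F₁ →
                All (λ w → prob p w ≤ prob p v) F₁ →
                Grow n (children v ++ F₁) b F′ →
                Grow (suc n) F (v ∷ b) F′

  -- WeightGreedyForest B rs L: L is an output for the subtrees rooted at rs,
  -- each of them being laid out separately.
  data WeightGreedyForest (B : ℕ) : List (Node t) → Layout t → Set where
    []  : WeightGreedyForest B [] []
    _∷_ : ∀ {r rs b F L L′} →
          Grow B [ r ] b F × WeightGreedyForest B F L →
          WeightGreedyForest B rs L′ →
          WeightGreedyForest B (r ∷ rs) ((b ∷ L) ++ L′)

  WeightGreedy : ℕ → Layout t → Set
  WeightGreedy B = WeightGreedyForest B [ here ]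

  -- DFSOrder rs vs: vs is the preorder of the subtrees rooted at rs, with
  -- siblings below rs visited in order of decreasing probability.
  data DFSOrder : List (Node t) → List (Node t) → Set where
    []    : DFSOrder [] []
    visit : ∀ {r rs cs us vs} →
            cs ↭ children r →
            AllPairs (λ u v → prob p v ≤ prob p u) cs →
            DFSOrder cs us →
            DFSOrder rs vs →
            DFSOrder (r ∷ rs) (r ∷ us ++ vs)

  data Cut (B : ℕ) : List (Node t) → Layout t → Set where
    []  : Cut B [] []
    cut : ∀ {v vs L} →
          Cut B (drop B (v ∷ vs)) L →
          Cut B (v ∷ vs) (take B (v ∷ vs) ∷ L)

  DFSGreedy : ℕ → Layout t → Set
  DFSGreedy B L = ∃[ vs ] DFSOrder [ here ] vs × Cut B vs L

data Heuristic : Set where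
  weightGreedy dfsGreedy : Heuristic

Produces : Heuristic → ℕ → ∀ {t} → (Leaf t → ℚ) → Layout t → Set
Produces weightGreedy B p = WeightGreedy p B
Produces dfsGreedy    B p = DFSGreedy p B

------------------------------------------------------------------------
-- x ≥ c · (log B / log log B) · y, cleared of the denominator.  As
-- ⌈log₂ B⌉ ≥ log₂ B and ⌊log₂ ⌊log₂ B⌋⌋ = ⌊log₂ log₂ B⌋ ≤ log₂ log₂ B, it
-- implies the inequality for real binary logarithms with the same c whenever
-- B ≥ 4 and y ≥ 0; the two are equivalent up to a constant factor in c.

AtLeastLogOverLogLog : (c : ℚ) (B : ℕ) (x y : ℚ) → Set
AtLeastLogOverLogLog c B x y =
  c * fromℕ ⌈log₂ B ⌉ * y ≤ fromℕ ⌊log₂ ⌊log₂ B ⌋ ⌋ * x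

{-# OPTIONS --safe #-}
module Submission where

-- Both heuristics are fooled by the same tree.  Every node of a complete
-- D-ary tree of depth k, the spine, gets as an additional child a path of
-- B - 1 nodes that is twice as probable as each of its spine children.
-- Either heuristic fills the block of a spine node with that path, so distinct
-- spine nodes lie in distinct blocks, whereas the whole spine fits into one
-- block and then every root-to-leaf path meets at most two blocks.  With
-- D + 2 ≥ 2k a random path meets at least (k + 1) / 2 spine nodes in
-- expectation, and k = Θ(log B / log log B) is compatible with
-- (D + 1) ^ k ≤ B.

open import Defs
open import Algebra.Bundles using (CommutativeRing)
import Algebra.Properties.CommutativeMonoid.Sum as Sum
import Algebra.Properties.Semiring.Sum as SemiringSum
open import Data.Empty using (⊥)
open import Data.Fin.Base using (Fin; zero; suc)
import Data.Fin.Properties as Fin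
open import Data.Integer.Base as ℤ using (+_)
import Data.Integer.Properties as ℤ
open import Data.List.Base
  using (List; []; _∷_; [_]; _++_; map; concat; tabulate; filter; length; take; drop; lookup)
import Data.List.Membership.DecPropositional as DecMembership
open import Data.List.Membership.Propositional using (_∈_; lose; find)
open import Data.List.Membership.Propositional.Properties
  using (∈-++⁺ˡ; ∈-++⁺ʳ; ∈-map⁺; ∈-map⁻; ∈-concat⁻; ∈-tabulate⁺; ∈-filter⁺; ∈-lookup)
open import Data.List.Properties
  using (++-identityʳ; ++-assoc; concat-++; concat-map; filter-none; length-++; length-map; map-++)
open import Data.List.Relation.Binary.Permutation.Propositional
  using (_↭_; ↭-refl; ↭-sym; ↭-trans; ↭-reflexive; prep; module PermutationReasoning)
import Data.List.Relation.Binary.Permutation.Propositional.Properties as ↭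
open import Data.List.Relation.Unary.All as All using (All; []; _∷_)
import Data.List.Relation.Unary.All.Properties as All
open import Data.List.Relation.Unary.AllPairs as AllPairs using (AllPairs; []; _∷_)
import Data.List.Relation.Unary.AllPairs.Properties as AllPairs
open import Data.List.Relation.Unary.Any as Any using (Any; here; there; any?)
import Data.List.Relation.Unary.Any.Properties as Any
open import Data.List.Relation.Unary.Unique.Propositional using (Unique)
import Data.List.Relation.Unary.Unique.Propositional.Properties as Unique
open import Data.Nat.Base as ℕ using (ℕ; zero; suc)
import Data.Nat.DivMod as ℕ
open import Data.Nat.Logarithm
  using (⌊log₂_⌋; ⌈log₂_⌉; ⌊log₂⌋-mono-≤; ⌈log₂⌉-mono-≤; ⌊log₂[2^n]⌋≡n; ⌈log₂2^n⌉≡n)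
import Data.Nat.Properties as ℕ
open import Data.Nat.Tactic.RingSolver using (solve-∀)
open import Data.Product.Base using (_×_; _,_; proj₁; proj₂; Σ-syntax; ∃-syntax; -,_)
open import Data.Rational.Base
  using ( ℚ; 0ℚ; 1ℚ; ½; _+_; _*_; _≤_; _<_; _/_; 1/_
        ; NonNegative; Positive; nonNegative; positive; toℚᵘ )
import Data.Rational.Properties as ℚ
open import Data.Rational.Solver using (module +-*-Solver)
open import Data.Rational.Unnormalised.Base as ℚᵘ using (mkℚᵘ)
import Data.Rational.Unnormalised.Properties as ℚᵘ
open import Data.Sum.Base using (_⊎_; inj₁; inj₂)
open import Data.Unit.Base using (⊤; tt)
open import Function.Base using (_∘_; case_of_)
import Relation.Binary.Reasoning.Setoid as SetoidReasoning
open import Relation.Binary.PropositionalEquality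
  using (_≡_; _≢_; refl; sym; trans; cong; cong₂; subst; module ≡-Reasoning)
open import Relation.Nullary using (¬_; contradiction; yes; no)
open import Relation.Unary using (Decidable)

open Sum ℚ.+-0-commutativeMonoid using (sum; sum-cong-≗; ∑-distrib-+)
open SemiringSum (CommutativeRing.semiring ℚ.+-*-commutativeRing) using (*-distribʳ-sum)

-- Descendants, and facts about lists.

data _⊑_ {t : Tree} : Node t → Node t → Set where
  self  : ∀ {v} → v ⊑ v
  below : ∀ {r u v} → u ∈ children r → u ⊑ v → r ⊑ v

there-⊑ : ∀ {d ts} (i : Fin d) {u v : Node (ts i)} → u ⊑ v → _⊑_ {node d ts} (there i u) (there i v)
there-⊑ i self        = self
there-⊑ i (below m s) = below (∈-map⁺ (there i) m) (there-⊑ i s)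

root-⊑ : ∀ {t} (v : Node t) → here ⊑ v
root-⊑ here        = self
root-⊑ (there i v) = below (∈-tabulate⁺ i) (there-⊑ i (root-⊑ v))

module _ {A : Set} where

  -- Pins down a greedy choice. With `R x` read as `q ≤ prob p x`, `v` of probability `q` and `ys`
  -- strictly lighter, a maximal `u` can only be `v`: otherwise `v` occurs in `xs`, so `R u` holds,
  -- while `u` occurs in `ys`, where `R` fails.
  ∈-head : ∀ {u v : A} {xs ys} {R : A → Set} →
           u ∷ xs ↭ v ∷ ys → (v ∈ xs → R u) → All (λ y → ¬ R y) ys → u ≡ v
  ∈-head {u} {v} eq f none with ↭.∈-resp-↭ (↭-sym eq) (here refl)
  ... | here v≡u = sym v≡u
  ... | there v∈xs with ↭.∈-resp-↭ eq (here refl)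
  ...   | here u≡v  = u≡v
  ...   | there u∈ys = contradiction (f v∈xs) (All.lookup none u∈ys)

  All-AllPairs : ∀ {P : A → Set} {R : A → A → Set} → (∀ {x y} → P x → P y → R x y) →
                 ∀ {xs} → All P xs → AllPairs R xs
  All-AllPairs r []         = []
  All-AllPairs r (px ∷ pxs) = All.map (r px) pxs ∷ All-AllPairs r pxs

  take-length-++ : ∀ {n} (xs : List A) {ys} → length xs ≡ n → take n (xs ++ ys) ≡ xs
  take-length-++ []       refl = refl
  take-length-++ (x ∷ xs) refl = cong (x ∷_) (take-length-++ xs refl)

  drop-length-++ : ∀ {n} (xs : List A) {ys} → length xs ≡ n → drop n (xs ++ ys) ≡ ys
  drop-length-++ []       refl = refl
  drop-length-++ (x ∷ xs) refl = drop-length-++ xs refl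

-- Behaviour of the two heuristics on combs.

module Greedy {t : Tree} (p : Leaf t → ℚ) (Spinal : Node t → Set) where

  -- A path of n nodes of probability q each, given by the list of its root;
  -- the list form makes children v the tail of a path through v.
  data Tail (q : ℚ) : ℕ → List (Node t) → Set where
    []   : Tail q 0 []
    tail : ∀ {n v} → ¬ Spinal v → prob p v ≡ q → Tail q n (children v) →
           Tail q (suc n) [ v ]

  -- The path below a spine node has n + 1 nodes: the block size is n + 2.
  data Comb (n : ℕ) (r : Node t) : Set where
    comb : ∀ {q q′ hs cs} → children r ≡ hs ++ cs → q′ < q →
           Tail q (suc n) hs → All (λ c → prob p c ≡ q′) cs → All (Comb n) cs →
           Comb n r

  AtMostOne : List (Node t) → Set
  AtMostOne b = ∀ {u v} → u ∈ b → v ∈ b → Spinal u → Spinal v → u ≡ v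

  -- The interface between the heuristics and the cost bound. Coverage ensures that each spinal node
  -- on a path is charged to an actual block.
  Separated : Layout t → Set
  Separated L = All AtMostOne L × (∀ v → Any (v ∈_) L)

  atMostOne-∷ : ∀ {r b} → All (¬_ ∘ Spinal) b → AtMostOne (r ∷ b)
  atMostOne-∷ none (here refl) (here refl) _  _  = refl
  atMostOne-∷ none (here refl) (there v∈b) _  sv = contradiction sv (All.lookup none v∈b)
  atMostOne-∷ none (there u∈b) _           su _  = contradiction su (All.lookup none u∈b)

  lighter : ∀ {q q′ cs} → q′ < q → All (λ c → prob p c ≡ q′) cs → All (λ c → ¬ (q ≤ prob p c)) cs
  lighter q′<q = All.map λ { refl q≤q′ → ℚ.<-irrefl refl (ℚ.<-≤-trans q′<q q≤q′) }

  -- Taking a node into the block exchanges it for its children in the frontier, so a descendant of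
  -- the frontier remains one until it is taken itself.
  grow-⊒ : ∀ {n F b F′ v} → Grow p n F b F′ → Any (_⊑ v) F → v ∈ b ⊎ Any (_⊑ v) F′
  grow-⊒ full         s = inj₂ s
  grow-⊒ exhausted    s = inj₂ s
  grow-⊒ (add {v = u} eq _ g) s with ↭.Any-resp-↭ eq s
  ... | here self = inj₁ (here refl)
  ... | here (below m s′) = case grow-⊒ g (Any.++⁺ˡ (lose m s′)) of λ
    { (inj₁ v∈b) → inj₁ (there v∈b) ; (inj₂ s″) → inj₂ s″ }
  ... | there s′ = case grow-⊒ g (Any.++⁺ʳ (children u) s′) of λ
    { (inj₁ v∈b) → inj₁ (there v∈b) ; (inj₂ s″) → inj₂ s″ }

  weightGreedy-⊒ : ∀ {B rs L v} → WeightGreedyForest p B rs L → Any (_⊑ v) rs → Any (v ∈_) L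
  weightGreedy-⊒ ((g , w) ∷ w′) (here s) with grow-⊒ g (here s)
  ... | inj₁ v∈b = here v∈b
  ... | inj₂ s′  = there (Any.++⁺ˡ (weightGreedy-⊒ w s′))
  weightGreedy-⊒ (_∷_ {b = b} {L = L} _ w′) (there s) = Any.++⁺ʳ (b ∷ L) (weightGreedy-⊒ w′ s)

  -- Invariant of growth: the frontier consists of the rest of the tail and the lighter `cs`. The
  -- head of the tail is strictly heaviest, so no tie can divert the choice, and its children are
  -- the next piece of the tail. The index `n` is both the room left and the tail length, so the
  -- block is full exactly when the tail is used up.
  grow-tail : ∀ {q n hs cs F b F′} → Tail q n hs → All (λ c → ¬ (q ≤ prob p c)) cs →
              F ↭ hs ++ cs → Grow p n F b F′ → All (¬_ ∘ Spinal) b × F′ ↭ cs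
  grow-tail []            lt eq full           = [] , eq
  grow-tail []            lt eq exhausted      = [] , eq
  grow-tail (tail _ _ _)  lt eq exhausted      = contradiction (↭-sym eq) ↭.¬x∷xs↭[]
  grow-tail (tail ¬s refl h) lt eq (add {v = u} eq′ max g)
    with refl ← ∈-head (↭-trans (↭-sym eq′) eq) (All.lookup max) lt
    with none , eq″ ← grow-tail h lt (↭.++⁺ˡ (children u) (↭.drop-∷ (↭-trans (↭-sym eq′) eq))) g
    = ¬s ∷ none , eq″

  -- The root takes one of the `n + 2` places and its tail of `n + 1` nodes takes the others. The
  -- frontier left over consists of the spine children, each a comb again.
  weightGreedy-atMostOne : ∀ {n rs L} → All (Comb n) rs →
                           WeightGreedyForest p (suc (suc n)) rs L → All AtMostOne L
  weightGreedy-atMostOne [] [] = []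
  weightGreedy-atMostOne (comb {cs = cs} eq q′<q h eqs c ∷ cs′) ((add {v = v} eq′ _ g , w) ∷ w′)
    -- The initial frontier is a singleton, so the first node added is the root.
    with refl ← ↭.↭-singleton-inv (↭-sym eq′)
    with none , eq″ ← grow-tail h (lighter q′<q eqs)
                        (↭-reflexive (trans (++-identityʳ (children v)) eq)) g
    = All.++⁺ (atMostOne-∷ none ∷ weightGreedy-atMostOne (↭.All-resp-↭ (↭-sym eq″) c) w)
              (weightGreedy-atMostOne cs′ w′)

  -- This and the other existence lemmas show that the bound on all outputs is not vacuous.
  grow-tail-exists : ∀ {q n hs cs} → Tail q n hs → All (λ c → prob p c ≤ q) cs →
                     ∃[ b ] Grow p n (hs ++ cs) b cs
  grow-tail-exists []              le = -, full
  grow-tail-exists (tail _ refl h) le = -, add ↭-refl le (proj₂ (grow-tail-exists h le))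

  weightGreedy-exists : ∀ {n rs} → All (Comb n) rs → ∃[ L ] WeightGreedyForest p (suc (suc n)) rs L
  weightGreedy-exists [] = -, []
  weightGreedy-exists {n} {r ∷ _} (comb {cs = cs} eq q′<q h eqs c ∷ cs′) =
    let b , g = grow-tail-exists h (All.map (λ { refl → ℚ.<⇒≤ q′<q }) eqs) in
    -, (add ↭-refl [] (subst (λ F → Grow p (suc n) F b cs)
                             (sym (trans (++-identityʳ (children r)) eq)) g)
       , proj₂ (weightGreedy-exists c))
       ∷ proj₂ (weightGreedy-exists cs′)

  dfsOrder-⊒ : ∀ {rs vs v} → DFSOrder p rs vs → Any (_⊑ v) rs → v ∈ vs
  dfsOrder-⊒ (visit eq _ o o′) (here self) = here refl
  dfsOrder-⊒ (visit eq _ o o′) (here (below m s)) =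
    there (∈-++⁺ˡ (dfsOrder-⊒ o (↭.Any-resp-↭ (↭-sym eq) (lose m s))))
  dfsOrder-⊒ (visit {us = us} eq _ o o′) (there s) = there (∈-++⁺ʳ us (dfsOrder-⊒ o′ s))

  tail-↭ : ∀ {q n hs hs′} → Tail q n hs → hs′ ↭ hs → hs′ ≡ hs
  tail-↭ []           eq = ↭.↭-empty-inv eq
  tail-↭ (tail _ _ _) eq = ↭.↭-singleton-inv eq

  dfsOrder-tail : ∀ {q n hs us} → Tail q n hs → DFSOrder p hs us →
                  length us ≡ n × All (¬_ ∘ Spinal) us
  dfsOrder-tail [] [] = refl , []
  dfsOrder-tail (tail ¬s _ h) (visit {us = us} eq _ o [])
    with refl ← tail-↭ h eq
    with len , none ← dfsOrder-tail h o
    rewrite ++-identityʳ us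
    = cong suc len , ¬s ∷ none

  Group : ℕ → List (Node t) → Set
  Group n g = length g ≡ n × AtMostOne g

  -- The tail is the strictly heaviest child, hence visited completely before any spine child. The
  -- preorder is therefore a sequence of groups, each a spine node followed by its tail and exactly
  -- one block long.
  dfsOrder-groups : ∀ {n rs vs} → All (Comb n) rs → DFSOrder p rs vs →
                    ∃[ gs ] vs ≡ concat gs × All (Group (suc (suc n))) gs
  dfsOrder-groups [] [] = [] , refl , []
  dfsOrder-groups {n} (comb {hs = v ∷ []} eq q′<q h@(tail ¬s refl h′) eqs c ∷ cs′)
    (visit {r} {cs = u ∷ cs} eq′ (max ∷ _) (visit {us = us} eq″ srt o₁ o₂) o₃)
    with eq‴ ← ↭-trans eq′ (↭-reflexive eq)
    with refl ← ∈-head eq‴ (All.lookup max) (lighter q′<q eqs)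
    -- The actual traversal continues with the spine siblings in `o₂`; ending it with `[]` isolates
    -- the tail. The `us ++ []` that results is simplified by the `rewrite` below.
    with len , none ← dfsOrder-tail h (visit eq″ srt o₁ [])
    with gs₁ , refl , ok₁ ← dfsOrder-groups (↭.All-resp-↭ (↭-sym (↭.drop-∷ eq‴)) c) o₂
    with gs₂ , refl , ok₂ ← dfsOrder-groups cs′ o₃
    rewrite ++-identityʳ us
    = (r ∷ u ∷ us) ∷ gs₁ ++ gs₂
    , cong (λ zs → r ∷ u ∷ zs) (trans (++-assoc us _ _) (cong (us ++_) (concat-++ gs₁ gs₂)))
    , (cong suc len , atMostOne-∷ none) ∷ All.++⁺ ok₁ ok₂
  dfsOrder-groups (comb eq _ (tail _ _ _) _ _ ∷ _) (visit {cs = []} eq′ _ _ _) =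
    contradiction (↭-sym (↭-trans eq′ (↭-reflexive eq))) ↭.¬x∷xs↭[]

  -- Every group, the last one included, has exactly the block size, so each cut falls on a group
  -- boundary.
  cut-groups : ∀ {B gs L} → All (λ g → length g ≡ suc B) gs → Cut p (suc B) (concat gs) L → L ≡ gs
  cut-groups [] [] = refl
  cut-groups {gs = (x ∷ g) ∷ gs} (len ∷ lens) (cut c)
    rewrite take-length-++ g {concat gs} (ℕ.suc-injective len)
          | drop-length-++ g {concat gs} (ℕ.suc-injective len)
    = cong ((x ∷ g) ∷_) (cut-groups lens c)

  cut-exists : ∀ {B gs} → All (λ g → length g ≡ suc B) gs → Cut p (suc B) (concat gs) gs
  cut-exists [] = []
  cut-exists {B} {(x ∷ g) ∷ gs} (len ∷ lens) =
    subst (λ b → Cut p (suc B) (x ∷ g ++ concat gs) ((x ∷ b) ∷ gs))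
      (take-length-++ g (ℕ.suc-injective len))
      (cut (subst (λ vs → Cut p (suc B) vs gs)
        (sym (drop-length-++ g (ℕ.suc-injective len))) (cut-exists lens)))

  tail-allPairs : ∀ {q n hs} {R : Node t → Node t → Set} → Tail q n hs → AllPairs R hs
  tail-allPairs []           = []
  tail-allPairs (tail _ _ _) = [] ∷ []

  dfsOrder-tail-exists : ∀ {q n hs} → Tail q n hs → ∃[ us ] DFSOrder p hs us
  dfsOrder-tail-exists []           = -, []
  dfsOrder-tail-exists (tail _ _ h) =
    -, visit ↭-refl (tail-allPairs h) (proj₂ (dfsOrder-tail-exists h)) []

  dfsOrder-++ : ∀ {rs rs′ us us′} → DFSOrder p rs us → DFSOrder p rs′ us′ →
                DFSOrder p (rs ++ rs′) (us ++ us′)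
  dfsOrder-++ [] o′ = o′
  dfsOrder-++ {us′ = us′} (visit {r} {us = us} {vs = vs} eq srt o₁ o₂) o′ =
    subst (λ ws → DFSOrder p _ (r ∷ ws)) (sym (++-assoc us vs us′))
      (visit eq srt o₁ (dfsOrder-++ o₂ o′))

  -- The list of children is already sorted: the tail is strictly heaviest and the spine children
  -- are equally probable.
  dfsOrder-exists : ∀ {n rs} → All (Comb n) rs → ∃[ vs ] DFSOrder p rs vs
  dfsOrder-exists [] = -, []
  dfsOrder-exists (comb {cs = cs} eq q′<q h@(tail _ refl _) eqs c ∷ cs′) =
    -, visit (↭-reflexive (sym eq))
         (All.map (λ { refl → ℚ.<⇒≤ q′<q }) eqs ∷ All-AllPairs (λ { refl e → ℚ.≤-reflexive e }) eqs)
         (dfsOrder-++ (proj₂ (dfsOrder-tail-exists h)) (proj₂ (dfsOrder-exists c)))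
         (proj₂ (dfsOrder-exists cs′))

  heuristic-separated : ∀ h {n L} → Comb n here → Produces h (suc (suc n)) p L → Separated L
  heuristic-separated weightGreedy c w =
    weightGreedy-atMostOne (c ∷ []) w , λ v → weightGreedy-⊒ w (here (root-⊑ v))
  heuristic-separated dfsGreedy c (vs , o , k) with dfsOrder-groups (c ∷ []) o
  ... | gs , refl , ok with refl ← cut-groups (All.map proj₁ ok) k =
    All.map proj₂ ok , λ v → ∈-concat⁻ gs (dfsOrder-⊒ o (here (root-⊑ v)))

  heuristic-exists : ∀ h {n} → Comb n here → ∃[ L ] Produces h (suc (suc n)) p L
  heuristic-exists weightGreedy c = weightGreedy-exists (c ∷ [])
  heuristic-exists dfsGreedy    c with dfsOrder-exists (c ∷ [])
  ... | vs , o with gs , refl , ok ← dfsOrder-groups (c ∷ []) o =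
    gs , vs , o , cut-exists (All.map proj₁ ok)

-- Counting the blocks met by a path.

touches? : ∀ {t} (ℓ : Leaf t) → Decidable (λ (b : List (Node t)) → Any (_∈ path ℓ) b)
touches? ℓ = any? (_∈? path ℓ)
  where open DecMembership _≟_ using (_∈?_)

lookup-injective : ∀ {A : Set} {xs : List A} → Unique xs → ∀ i j → lookup xs i ≡ lookup xs j → i ≡ j
lookup-injective (_  ∷ _) zero    zero    eq = refl
lookup-injective (x∉ ∷ _) zero    (suc j) eq = contradiction eq (All.lookup x∉ (∈-lookup j))
lookup-injective (x∉ ∷ _) (suc i) zero    eq = contradiction (sym eq) (All.lookup x∉ (∈-lookup i))
lookup-injective (_  ∷ u) (suc i) (suc j) eq = cong suc (lookup-injective u i j eq)

there-injective : ∀ {d ts} {i : Fin d} {u v : Node (ts i)} →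
                  _≡_ {A = Node (node d ts)} (there i u) (there i v) → u ≡ v
there-injective refl = refl

module _ {t : Tree} {p : Leaf t → ℚ} {Spinal : Node t → Set} where
  open Greedy p Spinal

  -- Each node of `xs` is sent to the position of its block among the blocks that meet the path.
  -- Nodes with the same position share a block, so separation identifies them and uniqueness of
  -- `xs` identifies their indices; the injection bounds the count.
  separated-blocks : ∀ {L ℓ xs} → Separated L → Unique xs → All Spinal xs → All (_∈ path ℓ) xs →
                     length xs ℕ.≤ blocksOnPath L ℓ
  separated-blocks {L} {ℓ} {xs} (one , cover) unique spinal onPath =
    Fin.injective⇒≤ position-injective
    where
    block : ∀ i → ∃[ b ] b ∈ L × lookup xs i ∈ b
    block i = find (cover (lookup xs i))

    block∈ : ∀ i → proj₁ (block i) ∈ filter (touches? ℓ) L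
    block∈ i = ∈-filter⁺ (touches? ℓ) (proj₁ (proj₂ (block i)))
      (lose (proj₂ (proj₂ (block i))) (All.lookup onPath (∈-lookup i)))

    position : Fin (length xs) → Fin (blocksOnPath L ℓ)
    position i = Any.index (block∈ i)

    position-injective : ∀ {i j} → position i ≡ position j → i ≡ j
    position-injective {i} {j} eq = lookup-injective unique i j
      (All.lookup one (proj₁ (proj₂ (block j)))
        (subst (lookup xs i ∈_) same (proj₂ (proj₂ (block i)))) (proj₂ (proj₂ (block j)))
        (All.lookup spinal (∈-lookup i)) (All.lookup spinal (∈-lookup j)))
      where
      same : proj₁ (block i) ≡ proj₁ (block j)
      same = trans (Any.lookup-index (block∈ i))
        (trans (cong (lookup (filter (touches? ℓ) L)) eq) (sym (Any.lookup-index (block∈ j))))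

MeetNoCommonPath : ∀ {t} → List (Node t) → List (Node t) → Set
MeetNoCommonPath {t} b b′ = ∀ (ℓ : Leaf t) → Any (_∈ path ℓ) b → ¬ Any (_∈ path ℓ) b′

length-filter-≤1 : ∀ {A : Set} {P : A → Set} (P? : Decidable P) {xs} →
                   AllPairs (λ x y → P x → ¬ P y) xs → length (filter P? xs) ℕ.≤ 1
length-filter-≤1 P? [] = ℕ.z≤n
length-filter-≤1 P? {x ∷ xs} (none ∷ apart) with P? x
... | no _ = length-filter-≤1 P? apart
... | yes px rewrite filter-none P? (All.map (λ f → f px) none) = ℕ.≤-refl

disjoint-blocks : ∀ {t} {L : Layout t} ℓ → AllPairs MeetNoCommonPath L → blocksOnPath L ℓ ℕ.≤ 1
disjoint-blocks ℓ apart = length-filter-≤1 (touches? ℓ) (AllPairs.map (λ f → f ℓ) apart)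

-- Rearranging concatenations of tabulated lists.

module _ {A : Set} where

  -- The spine layout lists the spine pieces of all branches before the tails, whereas `nodes`
  -- proceeds branch by branch; this reconciles the two orders.
  ++-concat-tabulate : ∀ {n} (f : Fin n → List A) (gs : Fin n → List (List A)) →
    concat (tabulate f) ++ concat (concat (tabulate gs)) ↭
    concat (tabulate λ i → f i ++ concat (gs i))
  ++-concat-tabulate {zero}  f gs = ↭-refl
  ++-concat-tabulate {suc n} f gs = begin
    (f zero ++ fs) ++ concat (gs zero ++ concat (tabulate (gs ∘ suc)))
      ≡⟨ cong ((f zero ++ fs) ++_) (concat-++ (gs zero) _) ⟨
    (f zero ++ fs) ++ concat (gs zero) ++ concat (concat (tabulate (gs ∘ suc)))
      ≡⟨ ++-assoc (f zero) fs _ ⟩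
    f zero ++ fs ++ concat (gs zero) ++ concat (concat (tabulate (gs ∘ suc)))
      ↭⟨ ↭.++⁺ˡ (f zero) (↭.shifts fs (concat (gs zero))) ⟩
    f zero ++ concat (gs zero) ++ fs ++ concat (concat (tabulate (gs ∘ suc)))
      ↭⟨ ↭.++⁺ˡ (f zero) (↭.++⁺ˡ (concat (gs zero)) (++-concat-tabulate (f ∘ suc) (gs ∘ suc))) ⟩
    f zero ++ concat (gs zero) ++ concat (tabulate λ i → f (suc i) ++ concat (gs (suc i)))
      ≡⟨ ++-assoc (f zero) (concat (gs zero)) _ ⟨
    (f zero ++ concat (gs zero)) ++ concat (tabulate λ i → f (suc i) ++ concat (gs (suc i))) ∎
    where
    open PermutationReasoning
    fs = concat (tabulate (f ∘ suc))

  concat-tabulate-↭ : ∀ {n} {f g : Fin n → List A} → (∀ i → f i ↭ g i) →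
                      concat (tabulate f) ↭ concat (tabulate g)
  concat-tabulate-↭ {zero}  eq = ↭-refl
  concat-tabulate-↭ {suc n} eq = ↭.++⁺ (eq zero) (concat-tabulate-↭ (eq ∘ suc))

  length-concat-tabulate : ∀ {n c} (f : Fin n → List A) → (∀ i → length (f i) ≡ c) →
                           length (concat (tabulate f)) ≡ n ℕ.* c
  length-concat-tabulate {zero}  f eq = refl
  length-concat-tabulate {suc n} f eq = trans (length-++ (f zero))
    (cong₂ ℕ._+_ (eq zero) (length-concat-tabulate (f ∘ suc) (eq ∘ suc)))

-- The tree, its spine and the layout meeting each path in at most two blocks.

-- chain n is a path of n + 1 nodes.
chain : ℕ → Tree
chain zero    = node 0 λ ()
chain (suc n) = node 1 λ _ → chain n

length-nodes-chain : ∀ n → length (nodes (chain n)) ≡ suc n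
length-nodes-chain zero    = refl
length-nodes-chain (suc n) = cong suc (trans (length-++ (map (there zero) (nodes (chain n))))
  (trans (ℕ.+-identityʳ _)
    (trans (length-map (there zero) (nodes (chain n))) (length-nodes-chain n))))

limbs : ∀ {n} → Tree → Tree → Fin (suc n) → Tree
limbs t t′ zero    = t
limbs t t′ (suc _) = t′

-- A path consists of the root and nodes of a single limb. Both blocks are images under `there`, so
-- neither contains the root.
meetNoCommonPath-there : ∀ {d} {ts : Fin d → Tree} {i j}
                           {b : List (Node (ts i))} {b′ : List (Node (ts j))} →
  i ≢ j → MeetNoCommonPath {node d ts} (map (there i) b) (map (there j) b′)
meetNoCommonPath-there i≢j ℓ m m′ with find (Any.map⁻ m) | find (Any.map⁻ m′)
meetNoCommonPath-there i≢j here m m′ | u , _ , here () | _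
meetNoCommonPath-there i≢j (there k ℓ) m m′ | u , _ , there x | v , _ , there y
  with _ , _ , refl ← ∈-map⁻ (there k) x | _ , _ , refl ← ∈-map⁻ (there k) y = i≢j refl

meetNoCommonPath-lift : ∀ {d} {ts : Fin d → Tree} {i} {b b′ : List (Node (ts i))} →
  MeetNoCommonPath b b′ → MeetNoCommonPath {node d ts} (map (there i) b) (map (there i) b′)
meetNoCommonPath-lift {i = i} apart ℓ m m′ with find (Any.map⁻ m) | find (Any.map⁻ m′)
meetNoCommonPath-lift apart here m m′ | u , _ , here () | _
meetNoCommonPath-lift apart (there k ℓ) m m′ | u , u∈b , there x | v , v∈b′ , there y
  with _ , x′ , refl ← ∈-map⁻ (there k) x | _ , y′ , refl ← ∈-map⁻ (there k) y =
  apart ℓ (lose u∈b x′) (lose v∈b′ y′)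

module Construction (m D : ℕ) where

  -- The tails have m + 1 nodes, for the block size m + 2.
  T : ℕ → Tree
  T zero    = chain (suc m)
  T (suc j) = node (suc D) (limbs (chain m) (T j))

  -- The top node of the final chain counts as spinal, so `T j` has `j + 1` spine levels and the
  -- lowest spine nodes carry a full tail too.
  Spinal : ∀ j → Node (T j) → Set
  Spinal zero    here                = ⊤
  Spinal zero    (there _ _)         = ⊥
  Spinal (suc j) here                = ⊤
  Spinal (suc j) (there zero _)      = ⊥
  Spinal (suc j) (there (suc i) v)   = Spinal j v

  spinePath : ∀ j → Leaf (T j) → List (Node (T j))
  spinePath zero    _                 = [ here ]
  spinePath (suc j) (there zero ℓ)    = [ here ]
  spinePath (suc j) (there (suc i) ℓ) = here ∷ map (there (suc i)) (spinePath j ℓ)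

  spinePath-unique : ∀ j ℓ → Unique (spinePath j ℓ)
  spinePath-unique zero    _                 = [] ∷ []
  spinePath-unique (suc j) (there zero ℓ)    = [] ∷ []
  spinePath-unique (suc j) (there (suc i) ℓ) =
    All.map⁺ (All.universal (λ _ ()) _) ∷ Unique.map⁺ there-injective (spinePath-unique j ℓ)

  spinePath-spinal : ∀ j ℓ → All (Spinal j) (spinePath j ℓ)
  spinePath-spinal zero    _                 = tt ∷ []
  spinePath-spinal (suc j) (there zero ℓ)    = tt ∷ []
  spinePath-spinal (suc j) (there (suc i) ℓ) = tt ∷ All.map⁺ (spinePath-spinal j ℓ)

  spinePath-path : ∀ j ℓ → All (_∈ path ℓ) (spinePath j ℓ)
  spinePath-path zero    (there _ _)       = here refl ∷ []
  spinePath-path (suc j) (there zero ℓ)    = here refl ∷ []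
  spinePath-path (suc j) (there (suc i) ℓ) =
    here refl ∷ All.map⁺ (All.map (λ x → there (∈-map⁺ (there (suc i)) x)) (spinePath-path j ℓ))

  spine : ∀ j → List (Node (T j))
  spine zero    = [ here ]
  spine (suc j) = here ∷ concat (tabulate λ i → map (there (suc i)) (spine j))

  tails : ∀ j → Layout (T j)
  tails zero    = [ map (there zero) (nodes (chain m)) ]
  tails (suc j) = map (there zero) (nodes (chain m))
                  ∷ concat (tabulate λ i → map (map (there (suc i))) (tails j))

  branchSpine : ∀ j → Fin D → List (Node (T (suc j)))
  branchSpine j i = map (there (suc i)) (spine j)

  branchTails : ∀ j → Fin D → Layout (T (suc j))
  branchTails j i = map (map (there (suc i))) (tails j)

  -- Crude geometric bound: with `s = suc D ^ j`, the induction step is `1 + D * s ≤ s + D * s`.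
  length-spine : ∀ j → length (spine j) ℕ.≤ suc D ℕ.^ j
  length-spine zero    = ℕ.≤-refl
  length-spine (suc j) = ℕ.+-mono-≤ (ℕ.m^n>0 (suc D) j) (ℕ.≤-trans
    (ℕ.≤-reflexive (length-concat-tabulate (branchSpine j) λ i →
      length-map (λ (v : Node (T j)) → there (suc i) v) (spine j)))
    (ℕ.*-monoʳ-≤ D (length-spine j)))

  spine-tails-↭ : ∀ j → spine j ++ concat (tails j) ↭ nodes (T j)
  spine-tails-↭ zero    = ↭-refl
  spine-tails-↭ (suc j) = prep here (begin
    -- The tail `c` of the root moves to the front, since `nodes` lists limb `zero` first.
    fs ++ c ++ concat (concat (tabulate gs))   ↭⟨ ↭.shifts fs c ⟩
    c ++ fs ++ concat (concat (tabulate gs))   ↭⟨ ↭.++⁺ˡ c (++-concat-tabulate f gs) ⟩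
    c ++ concat (tabulate λ i → f i ++ concat (gs i)) ↭⟨ ↭.++⁺ˡ c (concat-tabulate-↭ branch) ⟩
    c ++ concat (tabulate λ i → map (there (suc i)) (nodes (T j))) ∎)
    where
    open PermutationReasoning
    f  = branchSpine j
    gs = branchTails j
    c fs : List (Node (T (suc j)))
    c = map (there zero) (nodes (chain m))
    fs = concat (tabulate f)
    branch : ∀ i → f i ++ concat (gs i) ↭ map (there (suc i)) (nodes (T j))
    branch i = begin
      f i ++ concat (gs i)
        ≡⟨ cong (f i ++_) (concat-map (tails j)) ⟩
      f i ++ map (there (suc i)) (concat (tails j))
        ≡⟨ map-++ (there (suc i)) (spine j) (concat (tails j)) ⟨
      map (there (suc i)) (spine j ++ concat (tails j))
        ↭⟨ ↭.map⁺ (there (suc i)) (spine-tails-↭ j) ⟩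
      map (there (suc i)) (nodes (T j)) ∎

  -- Two tails part at the lowest spine node above both, where they lie in different limbs, and no
  -- path enters two limbs.
  tails-apart : ∀ j → AllPairs MeetNoCommonPath (tails j)
  tails-apart zero    = [] ∷ []
  tails-apart (suc j) =
    All.concat⁺ (All.tabulate⁺ {f = branchTails j} λ i →
      All.map⁺ (All.universal
        (λ b → meetNoCommonPath-there {i = zero} {suc i} {b′ = b} λ ()) (tails j)))
    ∷ AllPairs.concat⁺
        (All.tabulate⁺ {f = branchTails j} λ i →
          AllPairs.map⁺ (AllPairs.map meetNoCommonPath-lift (tails-apart j)))
        (AllPairs.tabulate⁺ {f = branchTails j} λ {i} {i′} i≢i′ →
          All.map⁺ (All.universal (λ b → All.map⁺ (All.universal
            (λ b′ → meetNoCommonPath-there {i = suc i} {suc i′} {b} {b′} λ { refl → i≢i′ refl })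
            (tails j))) (tails j)))

  length-tails : ∀ j → All (λ b → length b ≡ suc m) (tails j)
  length-tails zero    = trans (length-map _ (nodes (chain m))) (length-nodes-chain m) ∷ []
  length-tails (suc j) = trans (length-map _ (nodes (chain m))) (length-nodes-chain m)
    ∷ All.concat⁺ (All.tabulate⁺ {f = branchTails j} λ i → All.map⁺
        (All.map (λ {b} len → trans (length-map (λ (v : Node (T j)) → there (suc i) v) b) len)
          (length-tails j)))

  spineLayout : ∀ j → Layout (T j)
  spineLayout j = spine j ∷ tails j

  spineLayout-isLayout : ∀ j → suc D ℕ.^ j ℕ.≤ suc (suc m) → IsLayout (suc (suc m)) (spineLayout j)
  spineLayout-isLayout j le = spine-tails-↭ j ,
    ℕ.≤-trans (length-spine j) le
    ∷ All.map (λ { eq → ℕ.≤-trans (ℕ.≤-reflexive eq) (ℕ.n≤1+n _) }) (length-tails j)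

  -- One block for the spine and at most one for a tail.
  spineLayout-blocks : ∀ j ℓ → blocksOnPath (spineLayout j) ℓ ℕ.≤ 2
  spineLayout-blocks j ℓ with touches? ℓ (spine j)
  ... | yes _ = ℕ.s≤s (disjoint-blocks ℓ (tails-apart j))
  ... | no  _ = ℕ.m≤n⇒m≤1+n (disjoint-blocks ℓ (tails-apart j))

-- Arithmetic of `fromℕ` and sums over leaves.

toℚᵘ-fromℕ : ∀ n → toℚᵘ (fromℕ n) ℚᵘ.≃ mkℚᵘ (+ n) 0
toℚᵘ-fromℕ n = ℚ.toℚᵘ-fromℚᵘ (mkℚᵘ (+ n) 0)

-- `fromℕ` normalises its fraction, so sums do not compute on variables; for unnormalised rationals
-- with denominator 1 the law is one about integers.
fromℕ-+ : ∀ m n → fromℕ (m ℕ.+ n) ≡ fromℕ m + fromℕ n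
fromℕ-+ m n = ℚ.toℚᵘ-injective (begin
  toℚᵘ (fromℕ (m ℕ.+ n))                ≈⟨ toℚᵘ-fromℕ (m ℕ.+ n) ⟩
  mkℚᵘ (+ (m ℕ.+ n)) 0
    ≈⟨ ℚᵘ.*≡* (cong (ℤ._* + 1)
                (sym (cong₂ ℤ._+_ (ℤ.*-identityʳ (+ m)) (ℤ.*-identityʳ (+ n))))) ⟩
  mkℚᵘ (+ m) 0 ℚᵘ.+ mkℚᵘ (+ n) 0        ≈⟨ ℚᵘ.+-cong (toℚᵘ-fromℕ m) (toℚᵘ-fromℕ n) ⟨
  toℚᵘ (fromℕ m) ℚᵘ.+ toℚᵘ (fromℕ n)    ≈⟨ ℚ.toℚᵘ-homo-+ (fromℕ m) (fromℕ n) ⟨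
  toℚᵘ (fromℕ m + fromℕ n)              ∎)
  where open SetoidReasoning ℚᵘ.≃-setoid

fromℕ-suc : ∀ n → fromℕ (suc n) ≡ 1ℚ + fromℕ n
fromℕ-suc = fromℕ-+ 1

fromℕ-* : ∀ m n → fromℕ (m ℕ.* n) ≡ fromℕ m * fromℕ n
fromℕ-* zero    n = sym (ℚ.*-zeroˡ (fromℕ n))
fromℕ-* (suc m) n = begin
  fromℕ (n ℕ.+ m ℕ.* n)            ≡⟨ fromℕ-+ n (m ℕ.* n) ⟩
  fromℕ n + fromℕ (m ℕ.* n)        ≡⟨ cong₂ _+_ (sym (ℚ.*-identityˡ (fromℕ n))) (fromℕ-* m n) ⟩
  1ℚ * fromℕ n + fromℕ m * fromℕ n ≡⟨ ℚ.*-distribʳ-+ (fromℕ n) 1ℚ (fromℕ m) ⟨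
  (1ℚ + fromℕ m) * fromℕ n         ≡⟨ cong (_* fromℕ n) (fromℕ-suc m) ⟨
  fromℕ (suc m) * fromℕ n          ∎
  where open ≡-Reasoning

fromℕ-nonNegative : ∀ n → NonNegative (fromℕ n)
fromℕ-nonNegative n = ℚ.normalize-nonNeg n 1

fromℕ-mono-≤ : ∀ {m n} → m ℕ.≤ n → fromℕ m ≤ fromℕ n
fromℕ-mono-≤ {m} m≤n with o , refl ← ℕ.m≤n⇒∃[o]m+o≡n m≤n = begin
  fromℕ m           ≡⟨ ℚ.+-identityʳ (fromℕ m) ⟨
  fromℕ m + 0ℚ      ≤⟨ ℚ.+-monoʳ-≤ (fromℕ m) (ℚ.nonNegative⁻¹ (fromℕ o) {{fromℕ-nonNegative o}}) ⟩
  fromℕ m + fromℕ o ≡⟨ fromℕ-+ m o ⟨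
  fromℕ (m ℕ.+ o)   ∎
  where open ℚ.≤-Reasoning

0<1 : 0ℚ < 1ℚ
0<1 = ℚ.positive⁻¹ 1ℚ

sum-const : ∀ n x → sum {n} (λ _ → x) ≡ fromℕ n * x
sum-const zero    x = sym (ℚ.*-zeroˡ x)
sum-const (suc n) x = begin
  x + sum {n} (λ _ → x) ≡⟨ cong₂ _+_ (sym (ℚ.*-identityˡ x)) (sum-const n x) ⟩
  1ℚ * x + fromℕ n * x  ≡⟨ ℚ.*-distribʳ-+ x 1ℚ (fromℕ n) ⟨
  (1ℚ + fromℕ n) * x    ≡⟨ cong (_* x) (fromℕ-suc n) ⟨
  fromℕ (suc n) * x     ∎
  where open ≡-Reasoning

sum-mono-≤ : ∀ {n} {f g : Fin n → ℚ} → (∀ i → f i ≤ g i) → sum f ≤ sum g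
sum-mono-≤ {zero}  le = ℚ.≤-refl
sum-mono-≤ {suc n} le = ℚ.+-mono-≤ (le zero) (sum-mono-≤ (le ∘ suc))

∑leaves-mono-≤ : ∀ t {f g : Leaf t → ℚ} → (∀ ℓ → f ℓ ≤ g ℓ) → ∑leaves t f ≤ ∑leaves t g
∑leaves-mono-≤ (node zero    ts) le = le here
∑leaves-mono-≤ (node (suc d) ts) le = sum-mono-≤ λ i → ∑leaves-mono-≤ (ts i) (le ∘ there i)

∑leaves-cong : ∀ t {f g : Leaf t → ℚ} → (∀ ℓ → f ℓ ≡ g ℓ) → ∑leaves t f ≡ ∑leaves t g
∑leaves-cong (node zero    ts) eq = eq here
∑leaves-cong (node (suc d) ts) eq = sum-cong-≗ λ i → ∑leaves-cong (ts i) (eq ∘ there i)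

∑leaves-+ : ∀ t (f g : Leaf t → ℚ) → ∑leaves t (λ ℓ → f ℓ + g ℓ) ≡ ∑leaves t f + ∑leaves t g
∑leaves-+ (node zero    ts) f g = refl
∑leaves-+ (node (suc d) ts) f g = trans
  (sum-cong-≗ λ i → ∑leaves-+ (ts i) (f ∘ there i) (g ∘ there i))
  (∑-distrib-+ (λ i → ∑leaves (ts i) (f ∘ there i)) (λ i → ∑leaves (ts i) (g ∘ there i)))

∑leaves-* : ∀ t (f : Leaf t → ℚ) c → ∑leaves t (λ ℓ → f ℓ * c) ≡ ∑leaves t f * c
∑leaves-* (node zero    ts) f c = refl
∑leaves-* (node (suc d) ts) f c = trans
  (sum-cong-≗ λ i → ∑leaves-* (ts i) (f ∘ there i) c)
  (sym (*-distribʳ-sum c λ i → ∑leaves (ts i) (f ∘ there i)))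

∑leaves-chain : ∀ n w → ∑leaves (chain n) (λ _ → w) ≡ w
∑leaves-chain zero    w = refl
∑leaves-chain (suc n) w = trans (ℚ.+-identityʳ _) (∑leaves-chain n w)

-- Transporting combs from a subtree to the whole tree.

module _ {d : ℕ} {ts : Fin d → Tree}
         (p : Leaf (node d ts) → ℚ) (S : Node (node d ts) → Set) (i : Fin d) where
  private
    module Sub = Greedy (p ∘ there i) (S ∘ there i)
    module Sup = Greedy p S

  -- `prob p (there i v)` is `prob (p ∘ there i) v` by definition, and `children (there i v)` is the
  -- image of `children v`, so the structure carries over node by node.
  tail-there : ∀ {q n hs} → Sub.Tail q n hs → Sup.Tail q n (map (there i) hs)
  tail-there Sub.[]              = Sup.[]
  tail-there (Sub.tail ¬s eq h)  = Sup.tail ¬s eq (tail-there h)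

  comb-there : ∀ {n v} → Sub.Comb n v → Sup.Comb n (there i v)
  -- The recursion over the list is spelled out, mutually with `comb-there`, so that the descent
  -- into the nested `All` is visibly structural.
  combs-there : ∀ {n vs} → All (Sub.Comb n) vs → All (Sup.Comb n) (map (there i) vs)
  comb-there (Sub.comb {hs = hs} {cs} eq lt h eqs c) =
    Sup.comb (trans (cong (map (there i)) eq) (map-++ (there i) hs cs))
      lt (tail-there h) (All.map⁺ eqs) (combs-there c)
  combs-there []       = []
  combs-there (c ∷ cs) = comb-there c ∷ combs-there cs

tail-chain : ∀ n q → Greedy.Tail {chain n} (λ _ → q) (λ _ → ⊥) q (suc n) [ here ]
tail-chain zero    q = Greedy.tail (λ ()) refl Greedy.[]
tail-chain (suc n) q = Greedy.tail (λ ()) (∑leaves-chain (suc n) q)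
  (tail-there (λ _ → q) (λ _ → ⊥) zero (tail-chain n q))

-- Leaf weights and the expected number of spine nodes on a path.

module Weighting (m D : ℕ) (r : ℚ) (0<r : 0ℚ < r) (total : fromℕ D * r + (r + r) ≡ 1ℚ) where
  open Construction m D public

  instance
    r-positive : Positive r
    r-positive = positive 0<r

  -- Since D r + 2 r = 1, the weights of the leaves of T j add up to w.
  weight : ∀ j → ℚ → Leaf (T j) → ℚ
  weight zero    w _                 = w
  weight (suc j) w (there zero _)    = (r + r) * w
  weight (suc j) w (there (suc i) ℓ) = weight j (r * w) ℓ

  0<r* : ∀ {w} → 0ℚ < w → 0ℚ < r * w
  0<r* {w} 0<w = ℚ.positive⁻¹ (r * w) {{ℚ.pos*pos⇒pos r w {{positive 0<w}}}}

  r*<2r* : ∀ {w} → 0ℚ < w → r * w < (r + r) * w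
  r*<2r* {w} 0<w = begin-strict
    r * w         ≡⟨ ℚ.+-identityʳ (r * w) ⟨
    r * w + 0ℚ    <⟨ ℚ.+-monoʳ-< (r * w) (0<r* 0<w) ⟩
    r * w + r * w ≡⟨ ℚ.*-distribʳ-+ w r r ⟨
    (r + r) * w   ∎
    where open ℚ.≤-Reasoning

  weight-nonNeg : ∀ j {w} → 0ℚ < w → ∀ ℓ → 0ℚ ≤ weight j w ℓ
  weight-nonNeg zero    0<w _                 = ℚ.<⇒≤ 0<w
  weight-nonNeg (suc j) 0<w (there zero _)    = ℚ.<⇒≤ (ℚ.<-trans (0<r* 0<w) (r*<2r* 0<w))
  weight-nonNeg (suc j) 0<w (there (suc i) ℓ) = weight-nonNeg j (0<r* 0<w) ℓ

  regroup : ∀ w → (r + r) * w + fromℕ D * (r * w) ≡ w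
  regroup w = begin
    (r + r) * w + fromℕ D * (r * w)
      ≡⟨ solve 3 (λ r δ w → (r :+ r) :* w :+ δ :* (r :* w) := (δ :* r :+ (r :+ r)) :* w)
           refl r (fromℕ D) w ⟩
    (fromℕ D * r + (r + r)) * w     ≡⟨ cong (_* w) total ⟩
    1ℚ * w                          ≡⟨ ℚ.*-identityˡ w ⟩
    w                               ∎
    where
    open ≡-Reasoning
    open +-*-Solver

  ∑leaves-weight : ∀ j w → ∑leaves (T j) (weight j w) ≡ w
  ∑leaves-weight zero    w = ∑leaves-chain (suc m) w
  ∑leaves-weight (suc j) w = trans
    (cong₂ _+_ (∑leaves-chain m ((r + r) * w))
      (trans (sum-cong-≗ λ (_ : Fin D) → ∑leaves-weight j (r * w)) (sum-const D (r * w))))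
    (regroup w)

  comb-root : ∀ j {w} → 0ℚ < w → Greedy.Comb (weight j w) (Spinal j) m here
  comb-root zero    {w} 0<w =
    -- With no spine children their common probability is free; it is taken to be 0, which lies
    -- below `w`.
    Greedy.comb refl 0<w (tail-there (weight zero w) (Spinal zero) zero (tail-chain m w)) [] []
  comb-root (suc j) {w} 0<w =
    Greedy.comb refl (r*<2r* 0<w)
      (tail-there (weight (suc j) w) (Spinal (suc j)) zero (tail-chain m ((r + r) * w)))
      (All.tabulate⁺ λ i → ∑leaves-weight j (r * w))
      (All.tabulate⁺ λ i →
        comb-there (weight (suc j) w) (Spinal (suc j)) (suc i) (comb-root j (0<r* 0<w)))

  -- The total mass is `w` rather than 1, so that the recursion can pass to branches of mass
  -- `r * w`. At `w = 1` this is the expected number of spine nodes on a random path.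
  expectedDepth : ∀ j → ℚ → ℚ
  expectedDepth j w = ∑leaves (T j) λ ℓ → weight j w ℓ * fromℕ (length (spinePath j ℓ))

  -- Every path meets the root, which contributes the whole mass `w`. Beyond it a path into the tail
  -- meets no spine node, and each of the `D` branches is a copy of mass `r * w`.
  expectedDepth-suc : ∀ j w → expectedDepth (suc j) w ≡ w + fromℕ D * expectedDepth j (r * w)
  expectedDepth-suc j w = begin
    ∑leaves (chain m) (λ _ → (r + r) * w * 1ℚ) + sum (λ i → ∑leaves (T j) (branch i))
      ≡⟨ cong₂ _+_ (trans (∑leaves-chain m ((r + r) * w * 1ℚ)) (ℚ.*-identityʳ ((r + r) * w)))
                   (trans (sum-cong-≗ branch-sum) (sum-const D (r * w + σ))) ⟩
    (r + r) * w + fromℕ D * (r * w + σ)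
      ≡⟨ solve 4 (λ r δ w σ → (r :+ r) :* w :+ δ :* (r :* w :+ σ)
                              := ((r :+ r) :* w :+ δ :* (r :* w)) :+ δ :* σ) refl r (fromℕ D) w σ ⟩
    ((r + r) * w + fromℕ D * (r * w)) + fromℕ D * σ
      ≡⟨ cong (_+ fromℕ D * σ) (regroup w) ⟩
    w + fromℕ D * σ ∎
    where
    open ≡-Reasoning
    open +-*-Solver
    σ = expectedDepth j (r * w)
    branch : Fin D → Leaf (T j) → ℚ
    branch i ℓ = weight j (r * w) ℓ * fromℕ (length (spinePath (suc j) (there (suc i) ℓ)))
    branch-eq : ∀ i ℓ → branch i ℓ ≡
                weight j (r * w) ℓ + weight j (r * w) ℓ * fromℕ (length (spinePath j ℓ))
    branch-eq i ℓ = begin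
      x * fromℕ (suc (length (map (λ (v : Node (T j)) → there (suc i) v) (spinePath j ℓ))))
        ≡⟨ cong (λ n → x * fromℕ (suc n))
             (length-map (λ (v : Node (T j)) → there (suc i) v) (spinePath j ℓ)) ⟩
      x * fromℕ (suc (length (spinePath j ℓ)))
        ≡⟨ cong (x *_) (fromℕ-suc (length (spinePath j ℓ))) ⟩
      x * (1ℚ + fromℕ (length (spinePath j ℓ)))
        ≡⟨ ℚ.*-distribˡ-+ x 1ℚ _ ⟩
      x * 1ℚ + x * fromℕ (length (spinePath j ℓ))
        ≡⟨ cong (_+ x * fromℕ (length (spinePath j ℓ))) (ℚ.*-identityʳ x) ⟩
      x + x * fromℕ (length (spinePath j ℓ)) ∎
      where x = weight j (r * w) ℓ
    branch-sum : ∀ i → ∑leaves (T j) (branch i) ≡ r * w + σ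
    branch-sum i = trans (∑leaves-cong (T j) (branch-eq i)) (trans
      (∑leaves-+ (T j) (weight j (r * w))
        (λ ℓ → weight j (r * w) ℓ * fromℕ (length (spinePath j ℓ))))
      (cong (_+ σ) (∑leaves-weight j (r * w))))

  -- The fraction `r + r` of the mass escapes into the tail of the root, although the left-hand side
  -- credits it with all `j` remaining levels. The hypothesis bounds this excess by `w`, and the
  -- root is counted twice on the right, so its second copy pays for it.
  expectedDepth-≥ : ∀ j {w} → 0ℚ < w → fromℕ j * (r + r) ≤ 1ℚ →
                    fromℕ (suc j) * w ≤ expectedDepth j w + expectedDepth j w
  expectedDepth-≥ zero {w} 0<w _ = begin
    1ℚ * w      ≡⟨ ℚ.*-identityˡ w ⟩
    w           ≡⟨ ℚ.+-identityʳ w ⟨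
    w + 0ℚ      ≤⟨ ℚ.+-monoʳ-≤ w (ℚ.<⇒≤ 0<w) ⟩
    w + w       ≡⟨ cong₂ _+_ eq eq ⟨
    expectedDepth zero w + expectedDepth zero w ∎
    where
    open ℚ.≤-Reasoning
    eq : expectedDepth zero w ≡ w
    eq = trans (∑leaves-chain (suc m) (w * 1ℚ)) (ℚ.*-identityʳ w)
  expectedDepth-≥ (suc j) {w} 0<w small = begin
    fromℕ (suc (suc j)) * w
      ≡⟨ cong (_* w) (fromℕ-suc (suc j)) ⟩
    (1ℚ + J) * w
      ≡⟨ solve 2 (λ J w → (con 1ℚ :+ J) :* w := w :+ J :* w) refl J w ⟩
    w + J * w
      -- Only the second `w` is split between tail and branches; the first one stands for the root.
      ≡⟨ cong (λ x → w + J * x) (regroup w) ⟨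
    w + J * ((r + r) * w + δ * (r * w))
      ≡⟨ solve 4 (λ r δ w J → w :+ J :* ((r :+ r) :* w :+ δ :* (r :* w))
                              := (w :+ (J :* (r :+ r)) :* w) :+ δ :* (J :* (r :* w)))
           refl r δ w J ⟩
    (w + (J * (r + r)) * w) + δ * (J * (r * w))
      ≤⟨ ℚ.+-mono-≤
           (ℚ.+-monoʳ-≤ w (ℚ.*-monoʳ-≤-nonNeg w {{nonNegative (ℚ.<⇒≤ 0<w)}} small))
           (ℚ.*-monoˡ-≤-nonNeg δ {{fromℕ-nonNegative D}} (expectedDepth-≥ j (0<r* 0<w) small′)) ⟩
    (w + 1ℚ * w) + δ * (σ + σ)
      ≡⟨ solve 3 (λ w δ σ → (w :+ con 1ℚ :* w) :+ δ :* (σ :+ σ)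
                            := (w :+ δ :* σ) :+ (w :+ δ :* σ)) refl w δ σ ⟩
    (w + δ * σ) + (w + δ * σ)
      ≡⟨ cong₂ _+_ (expectedDepth-suc j w) (expectedDepth-suc j w) ⟨
    expectedDepth (suc j) w + expectedDepth (suc j) w ∎
    where
    open ℚ.≤-Reasoning
    open +-*-Solver
    J = fromℕ (suc j)
    δ = fromℕ D
    σ = expectedDepth j (r * w)
    small′ : fromℕ j * (r + r) ≤ 1ℚ
    small′ = ℚ.≤-trans (ℚ.*-monoʳ-≤-nonNeg (r + r) {{2r-nonNeg}} (fromℕ-mono-≤ (ℕ.n≤1+n j))) small
      where
      2r-nonNeg : NonNegative (r + r)
      2r-nonNeg = ℚ.nonNeg+nonNeg⇒nonNeg r {{ℚ.pos⇒nonNeg r}} r {{ℚ.pos⇒nonNeg r}}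

  module _ (j : ℕ) where
    p : Leaf (T j) → ℚ
    p = weight j 1ℚ

    open Greedy p (Spinal j)

    isDistribution : IsDistribution (T j) p
    isDistribution = weight-nonNeg j 0<1 , ∑leaves-weight j 1ℚ

    separated-cost : ∀ {L} → Separated L → expectedDepth j 1ℚ ≤ expectedCost p L
    separated-cost {L} sep = ∑leaves-mono-≤ (T j) λ ℓ →
      ℚ.*-monoˡ-≤-nonNeg (p ℓ) {{nonNegative (weight-nonNeg j 0<1 ℓ)}}
        (fromℕ-mono-≤ (separated-blocks {p = p} {Spinal j} {L} {ℓ} sep
          (spinePath-unique j ℓ) (spinePath-spinal j ℓ) (spinePath-path j ℓ)))

    spineLayout-cost : expectedCost p (spineLayout j) ≤ fromℕ 2
    spineLayout-cost = begin
      expectedCost p (spineLayout j)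
        ≤⟨ ∑leaves-mono-≤ (T j) (λ ℓ →
             ℚ.*-monoˡ-≤-nonNeg (p ℓ) {{nonNegative (weight-nonNeg j 0<1 ℓ)}}
               (fromℕ-mono-≤ (spineLayout-blocks j ℓ))) ⟩
      ∑leaves (T j) (λ ℓ → p ℓ * fromℕ 2) ≡⟨ ∑leaves-* (T j) p (fromℕ 2) ⟩
      ∑leaves (T j) p * fromℕ 2           ≡⟨ cong (_* fromℕ 2) (∑leaves-weight j 1ℚ) ⟩
      1ℚ * fromℕ 2                        ≡⟨ ℚ.*-identityˡ (fromℕ 2) ⟩
      fromℕ 2                             ∎
      where open ℚ.≤-Reasoning

-- Choosing degree and depth for a given block size.

between-powers : ∀ n → ∃[ a ] 2 ℕ.^ a ℕ.≤ suc n × suc n ℕ.< 2 ℕ.^ suc a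
between-powers zero = 0 , ℕ.≤-refl , ℕ.≤-refl
between-powers (suc n) with a , lo , hi ← between-powers n with suc (suc n) ℕ.<? 2 ℕ.^ suc a
... | yes hi′ = a , ℕ.m≤n⇒m≤1+n lo , hi′
... | no  hi′ = suc a , ℕ.≮⇒≥ hi′ , ℕ.≤-<-trans hi (ℕ.^-monoʳ-< 2 ℕ.≤-refl (ℕ.n<1+n (suc a)))

2^a≤n⇒a≤⌊log₂n⌋ : ∀ a {n} → 2 ℕ.^ a ℕ.≤ n → a ℕ.≤ ⌊log₂ n ⌋
2^a≤n⇒a≤⌊log₂n⌋ a le = ℕ.≤-trans (ℕ.≤-reflexive (sym (⌊log₂[2^n]⌋≡n a))) (⌊log₂⌋-mono-≤ le)

n≤2^a⇒⌈log₂n⌉≤a : ∀ a {n} → n ℕ.≤ 2 ℕ.^ a → ⌈log₂ n ⌉ ℕ.≤ a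
n≤2^a⇒⌈log₂n⌉≤a a le = ℕ.≤-trans (⌈log₂⌉-mono-≤ le) (ℕ.≤-reflexive (⌈log₂2^n⌉≡n a))

-- `fits` puts the spine into one block; `shallow` is the hypothesis of `expectedDepth-≥` for
-- `r = 1 / (degree + 2)`; `deep` says that, up to rounding, log B / log log B is at most
-- `3 * (depth + 1)`.
record Parameters (B : ℕ) : Set where
  field
    degree depth : ℕ
    fits         : suc degree ℕ.^ depth ℕ.≤ B
    shallow      : depth ℕ.+ depth ℕ.≤ 2 ℕ.+ degree
    deep         : ⌈log₂ B ⌉ ℕ.≤ 3 ℕ.* (⌊log₂ ⌊log₂ B ⌋ ⌋ ℕ.* suc depth)

-- With a = ⌊log₂ B⌋ and 1 + b = ⌊log₂ a⌋, a power of two exceeding 2a is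
-- taken for the degree plus 2, and for the depth the largest k with
-- (degree + 2) ^ k ≤ 2 ^ a.
parameters′ : ∀ {B} a b → 2 ℕ.^ a ℕ.≤ B → B ℕ.< 2 ℕ.^ suc a →
              2 ℕ.^ suc b ℕ.≤ a → a ℕ.< 2 ℕ.^ (2 ℕ.+ b) → Parameters B
parameters′ {B} a b loB hiB loa hia = record
  { degree  = degree
  ; depth   = k
  ; fits    = begin
      -- Passing to `degree + 2`, a power of two, leaves only the exponents `k * c` and `a` to
      -- compare.
      suc degree ℕ.^ k     ≤⟨ ℕ.^-monoˡ-≤ k (ℕ.n≤1+n (suc degree)) ⟩
      (2 ℕ.+ degree) ℕ.^ k ≡⟨ cong (ℕ._^ k) degree-eq ⟩
      (2 ℕ.^ c) ℕ.^ k      ≡⟨ ℕ.^-*-assoc 2 c k ⟩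
      2 ℕ.^ (c ℕ.* k)      ≡⟨ cong (2 ℕ.^_) (ℕ.*-comm c k) ⟩
      2 ℕ.^ (k ℕ.* c)      ≤⟨ ℕ.^-monoʳ-≤ 2 (ℕ.m/n*n≤m a c) ⟩
      2 ℕ.^ a              ≤⟨ loB ⟩
      B                    ∎
  ; shallow = begin
      -- The crude bound `k ≤ a` suffices: `a` lies below `c′`, which is half of `degree + 2`.
      k ℕ.+ k      ≤⟨ ℕ.+-mono-≤ k≤ k≤ ⟩
      c′ ℕ.+ c′    ≡⟨ cong (c′ ℕ.+_) (ℕ.+-identityʳ c′) ⟨
      2 ℕ.^ c      ≡⟨ degree-eq ⟨
      2 ℕ.+ degree ∎
  ; deep    = begin
      ⌈log₂ B ⌉                           ≤⟨ n≤2^a⇒⌈log₂n⌉≤a (suc a) (ℕ.<⇒≤ hiB) ⟩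
      suc a                               ≤⟨ a< ⟩
      -- The factor 3 comes from `3 + b ≤ 3 * (1 + b)`, whose slack is `b + b`.
      x ℕ.* (3 ℕ.+ b)                     ≤⟨ ℕ.m≤m+n (x ℕ.* (3 ℕ.+ b)) (x ℕ.* (b ℕ.+ b)) ⟩
      x ℕ.* (3 ℕ.+ b) ℕ.+ x ℕ.* (b ℕ.+ b) ≡⟨ rearrange x b ⟩
      3 ℕ.* (suc b ℕ.* x)                 ≤⟨ ℕ.*-monoʳ-≤ 3 (ℕ.*-monoˡ-≤ x b<) ⟩
      3 ℕ.* (⌊log₂ ⌊log₂ B ⌋ ⌋ ℕ.* x)     ∎
  }
  where
  open ℕ.≤-Reasoning
  c = 3 ℕ.+ b
  c′ = 2 ℕ.^ (2 ℕ.+ b)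
  k = a ℕ./ c
  x = suc k
  degree = 2 ℕ.^ c ℕ.∸ 2
  degree-eq : 2 ℕ.+ degree ≡ 2 ℕ.^ c
  degree-eq = ℕ.m+[n∸m]≡n (ℕ.^-monoʳ-≤ 2 {1} {c} (ℕ.s≤s ℕ.z≤n))
  k≤ : k ℕ.≤ c′
  k≤ = ℕ.≤-trans (ℕ.m/n≤m a c) (ℕ.<⇒≤ hia)
  a< : a ℕ.< suc k ℕ.* c
  a< = begin-strict
    a                     ≡⟨ ℕ.m≡m%n+[m/n]*n a c ⟩
    a ℕ.% c ℕ.+ k ℕ.* c   <⟨ ℕ.+-monoˡ-< (k ℕ.* c) (ℕ.m%n<n a c) ⟩
    suc k ℕ.* c           ∎
  b< : b ℕ.< ⌊log₂ ⌊log₂ B ⌋ ⌋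
  b< = 2^a≤n⇒a≤⌊log₂n⌋ (suc b) (ℕ.≤-trans loa (2^a≤n⇒a≤⌊log₂n⌋ a loB))
  rearrange : ∀ x b → x ℕ.* (3 ℕ.+ b) ℕ.+ x ℕ.* (b ℕ.+ b) ≡ 3 ℕ.* (suc b ℕ.* x)
  rearrange = solve-∀

parameters : ∀ n → Parameters (4 ℕ.+ n)
parameters n with between-powers (3 ℕ.+ n)
-- A block size of at least 4 has rounded logarithm at least 2, whose own rounded logarithm is at
-- least 1; hence the forms `suc (suc a)` and `suc b`.
... | 0           , _   , ℕ.s≤s (ℕ.s≤s ())
... | 1           , _   , ℕ.s≤s (ℕ.s≤s (ℕ.s≤s (ℕ.s≤s ())))
... | suc (suc a) , loB , hiB with between-powers (suc a)
...   | 0     , _   , ℕ.s≤s (ℕ.s≤s ())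
...   | suc b , loa , hia = parameters′ (suc (suc a)) b loB hiB loa hia

-- The constants and the assembly of the instance.

fromℕ-positive : ∀ n → Positive (fromℕ (suc n))
fromℕ-positive n = ℚ.normalize-pos (suc n) 1

-- The value of `r` forced by `D r + 2 r = 1`.
scale : ℕ → ℚ
scale D = (1/ fromℕ (2 ℕ.+ D)) {{ℚ.pos⇒nonZero (fromℕ (2 ℕ.+ D)) {{fromℕ-positive (suc D)}}}}

scale-positive : ∀ D → Positive (scale D)
scale-positive D = ℚ.1/pos⇒pos (fromℕ (2 ℕ.+ D)) {{fromℕ-positive (suc D)}}

scale-inverse : ∀ D → fromℕ (2 ℕ.+ D) * scale D ≡ 1ℚ
scale-inverse D =
  ℚ.*-inverseʳ N {{ℚ.pos⇒nonZero N {{fromℕ-positive (suc D)}}}}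
  where N = fromℕ (2 ℕ.+ D)

scale-total : ∀ D → fromℕ D * scale D + (scale D + scale D) ≡ 1ℚ
scale-total D = begin
  fromℕ D * scale D + (scale D + scale D)
    ≡⟨ solve 2 (λ δ r → δ :* r :+ (r :+ r) := (con (fromℕ 2) :+ δ) :* r)
         refl (fromℕ D) (scale D) ⟩
  (fromℕ 2 + fromℕ D) * scale D           ≡⟨ cong (_* scale D) (fromℕ-+ 2 D) ⟨
  fromℕ (2 ℕ.+ D) * scale D               ≡⟨ scale-inverse D ⟩
  1ℚ                                      ∎
  where
  open ≡-Reasoning
  open +-*-Solver

scale-shallow : ∀ D k → k ℕ.+ k ℕ.≤ 2 ℕ.+ D → fromℕ k * (scale D + scale D) ≤ 1ℚ
scale-shallow D k le = begin
  fromℕ k * (scale D + scale D)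
    ≡⟨ solve 2 (λ κ r → κ :* (r :+ r) := (κ :+ κ) :* r) refl (fromℕ k) (scale D) ⟩
  (fromℕ k + fromℕ k) * scale D  ≡⟨ cong (_* scale D) (fromℕ-+ k k) ⟨
  fromℕ (k ℕ.+ k) * scale D
    ≤⟨ ℚ.*-monoʳ-≤-nonNeg (scale D) {{ℚ.pos⇒nonNeg (scale D) {{scale-positive D}}}}
         (fromℕ-mono-≤ le) ⟩
  fromℕ (2 ℕ.+ D) * scale D      ≡⟨ scale-inverse D ⟩
  1ℚ                             ∎
  where
  open ℚ.≤-Reasoning
  open +-*-Solver

-- The constant is `1 / (3 * 2 * 2)`: the 3 comes from `deep`, one 2 from the doubled greedy cost
-- `x + x`, the other from the bound on the optimal cost `y`.
atLeastLogOverLogLog : ∀ {B d x y} → ⌈log₂ B ⌉ ℕ.≤ 3 ℕ.* (⌊log₂ ⌊log₂ B ⌋ ⌋ ℕ.* d) →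
  fromℕ d ≤ x + x → y ≤ fromℕ 2 → AtLeastLogOverLogLog (+ 1 / 12) B x y
atLeastLogOverLogLog {B} {d} {x} {y} deep d≤2x y≤2 = begin
  c * A * y
    ≤⟨ ℚ.*-monoˡ-≤-nonNeg (c * A)
         {{ℚ.nonNeg*nonNeg⇒nonNeg c A {{fromℕ-nonNegative ⌈log₂ B ⌉}}}} y≤2 ⟩
  c * A * fromℕ 2
    ≤⟨ ℚ.*-monoʳ-≤-nonNeg (fromℕ 2) (ℚ.*-monoˡ-≤-nonNeg c (fromℕ-mono-≤ deep)) ⟩
  c * fromℕ (3 ℕ.* (l ℕ.* d)) * fromℕ 2
    ≡⟨ cong (λ z → c * z * fromℕ 2)
         (trans (fromℕ-* 3 (l ℕ.* d)) (cong (fromℕ 3 *_) (fromℕ-* l d))) ⟩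
  c * (fromℕ 3 * (fromℕ l * fromℕ d)) * fromℕ 2
    ≡⟨ solve 2 (λ l d → con c :* (con (fromℕ 3) :* (l :* d)) :* con (fromℕ 2)
                        := con ½ :* (l :* d)) refl (fromℕ l) (fromℕ d) ⟩
  ½ * (fromℕ l * fromℕ d)
    ≤⟨ ℚ.*-monoˡ-≤-nonNeg ½ (ℚ.*-monoˡ-≤-nonNeg (fromℕ l) {{fromℕ-nonNegative l}} d≤2x) ⟩
  ½ * (fromℕ l * (x + x))
    ≡⟨ solve 2 (λ l x → con ½ :* (l :* (x :+ x)) := l :* x) refl (fromℕ l) x ⟩
  fromℕ l * x ∎
  where
  open ℚ.≤-Reasoning
  open +-*-Solver
  c = + 1 / 12
  A = fromℕ ⌈log₂ B ⌉
  l = ⌊log₂ ⌊log₂ B ⌋ ⌋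

FoolingInstance : Heuristic → ℚ → ℕ → Set
FoolingInstance h c B =
  Σ[ t ∈ Tree ] Σ[ p ∈ (Leaf t → ℚ) ] IsDistribution t p ×
  (∃[ G ] Produces h B p G) ×
  ((G O : Layout t) → Produces h B p G → IsOptimal B p O →
   AtLeastLogOverLogLog c B (expectedCost p G) (expectedCost p O))

foolingInstance : ∀ h m → Parameters (2 ℕ.+ m) → FoolingInstance h (+ 1 / 12) (2 ℕ.+ m)
foolingInstance h m params = T k , p k , isDistribution k ,
  Greedy.heuristic-exists (p k) (Spinal k) h (comb-root k 0<1) ,
  λ G O produced (_ , optimal) → atLeastLogOverLogLog {2 ℕ.+ m} {suc k} deep
    (greedy-cost G produced)
    -- An optimal layout costs at most as much as the spine layout, hence at most 2.
    (ℚ.≤-trans (optimal (spineLayout k) (spineLayout-isLayout k fits)) (spineLayout-cost k))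
  where
  open Parameters params renaming (degree to D; depth to k)
  open Weighting m D (scale D) (ℚ.positive⁻¹ (scale D) {{scale-positive D}}) (scale-total D)
  open ℚ.≤-Reasoning
  greedy-cost : ∀ G → Produces h (2 ℕ.+ m) (p k) G →
                fromℕ (suc k) ≤ expectedCost (p k) G + expectedCost (p k) G
  greedy-cost G produced = begin
    fromℕ (suc k)                             ≡⟨ ℚ.*-identityʳ (fromℕ (suc k)) ⟨
    fromℕ (suc k) * 1ℚ                        ≤⟨ expectedDepth-≥ k 0<1 (scale-shallow D k shallow) ⟩
    expectedDepth k 1ℚ + expectedDepth k 1ℚ   ≤⟨ ℚ.+-mono-≤ spine≤cost spine≤cost ⟩
    expectedCost (p k) G + expectedCost (p k) G ∎
    where
    spine≤cost : expectedDepth k 1ℚ ≤ expectedCost (p k) G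
    spine≤cost = separated-cost k
      (Greedy.heuristic-separated (p k) (Spinal k) h (comb-root k 0<1) produced)

theorem1 : (h : Heuristic) →
    Σ[ c ∈ ℚ ] Σ[ B₀ ∈ ℕ ] 0ℚ < c ×
    ((B : ℕ) → B₀ ℕ.≤ B →
    Σ[ t ∈ Tree ] Σ[ p ∈ (Leaf t → ℚ) ] IsDistribution t p ×
    (∃[ G ] Produces h B p G) ×
    ((G O : Layout t) → Produces h B p G → IsOptimal B p O →
    AtLeastLogOverLogLog c B (expectedCost p G) (expectedCost p O)))
theorem1 h = + 1 / 12 , 4 , ℚ.positive⁻¹ (+ 1 / 12) , λ B 4≤B → instance-for (ℕ.m≤n⇒∃[o]m+o≡n 4≤B)
  where
  instance-for : ∀ {B} → ∃[ n ] 4 ℕ.+ n ≡ B → FoolingInstance h (+ 1 / 12) B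
  -- The block size `4 + n` is read as `2 + m` with `m = 2 + n`, so the tails have `n + 3` nodes.
  instance-for (n , refl) = foolingInstance h (2 ℕ.+ n) (parameters n)
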